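{- Every DP graph $G=(V,E)$ of diameter at least six belongs to $Ext_2$.
   Context: All graphs are finite, undirected, simple and connected unless obtained by deleting vertices. A dominating pair of a graph consists of two vertices $x,y$ such that the vertex set of every $xy$-path is a dominating set of the graph ($x=y$ is allowed). A DP graph (dominating pair graph) is a graph such that every connected induced subgraph contains a dominating pair. Extremity: a vertex $v$ of a connected graph $G$ such that removing its closed neighbourhood $N[v]$ does not increase the number of connected components (i.e. $G\setminus N[v]$ has at most one connected component). Module: a set $M\subseteq V$ such that $N(x)\setminus M=N(y)\setminus M$ for all $x,y\in M$. A module $M$ is strong if for every module $M'$, either $M\subseteq M'$, or $M'\subseteq M$, or $M\cap M'=\emptyset$. Let $\mathcal{M}(G)$ be the family of all inclusion-wise maximal strong modules of $G$ different from $V$. The quotient graph of $G$ has vertex set $\mathcal{M}(G)$, with an edge between distinct $M,M'\in\mathcal{M}(G)$ iff every vertex of $M$ is adjacent to every vertex of $M'$. $Ext_{\alpha}$ is the class of all (connected) graphs whose quotient graph contains no more than $\alpha$ pairwise nonadjacent extremities. -}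

module Defs where

open import Data.Bool using () renaming (_≟_ to _≟ᵇ_)
open import Data.Fin using (Fin)
open import Data.Fin.Properties using (all?)
open import Data.Fin.Subset
  using (Subset; inside; outside; _∈_; _⊆_; _∪_; _∩_; _─_; ∁; ⁅_⁆; ∣_∣; Nonempty; Empty)
  renaming (⊤ to full)
open import Data.Fin.Subset.Properties using (_∈?_; _⊆?_; nonempty?; anySubset?)
open import Data.List using (List; []; _∷_; _++_; map; filter; length; lookup; head; last)
open import Data.List.Relation.Unary.All using (All)
open import Data.List.Relation.Unary.Any using (Any)
open import Data.List.Relation.Unary.Linked using (Linked)
open import Data.List.Relation.Unary.Unique.Propositional using (Unique)
open import Data.Maybe using (just)
open import Data.Nat using (ℕ; zero; suc; pred; _≤_)
open import Data.Product using (∃; ∃₂; _×_; _,_)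
open import Data.Sum using (_⊎_)
open import Data.Vec using ([]; _∷_; tabulate)
open import Data.Vec.Properties using (≡-dec)
open import Level using (0ℓ)
open import Relation.Binary using (Rel; Decidable; Symmetric; Irreflexive; DecidableEquality)
open import Relation.Binary.PropositionalEquality using (_≡_; _≢_; refl; sym)
open import Relation.Nullary using (Dec; ¬_; does)
open import Relation.Nullary.Decidable using (map′; ¬?; _×-dec_; _⊎-dec_; _→-dec_; decidable-stable)
import Relation.Unary as U

record Graph (n : ℕ) : Set₁ where
  infix 4 _~_ _~?_
  field
    _~_      : Rel (Fin n) 0ℓ
    _~?_     : Decidable _~_
    ~-sym    : Symmetric _~_
    ~-irrefl : Irreflexive _≡_ _~_

  N : Fin n → Subset n
  N x = tabulate (λ y → does (x ~? y))

  N[_] : Fin n → Subset n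
  N[ x ] = N x ∪ ⁅ x ⁆

-- The induced subgraph G[S] is represented by the pair of G and S; the
-- notions below that take a subset S are those of the graph G[S], and G
-- itself is the case S = full.
module _ {n : ℕ} (G : Graph n) where
  open Graph G

  record IsPath (S : Subset n) (x y : Fin n) (p : List (Fin n)) : Set where
    field
      starts : head p ≡ just x
      ends   : last p ≡ just y
      linked : Linked _~_ p
      unique : Unique p
      within : All (_∈ S) p

  -- Edges, not vertices.
  pathLength : List (Fin n) → ℕ
  pathLength p = pred (length p)

  -- The connected components of G[S] are the classes of the relation
  -- "joined by a path in G[S]" on S.
  AtMostOneComponent : Subset n → Set
  AtMostOneComponent S = ∀ x y → x ∈ S → y ∈ S → ∃ (IsPath S x y)

  Connected : Subset n → Set
  Connected S = Nonempty S × AtMostOneComponent S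

  ConnectedGraph : Set
  ConnectedGraph = Connected full

  IsDistance : Fin n → Fin n → ℕ → Set
  IsDistance x y d =
    (∃ λ p → IsPath full x y p × pathLength p ≡ d) ×
    (∀ p → IsPath full x y p → d ≤ pathLength p)

  IsDiameter : ℕ → Set
  IsDiameter D =
    (∃₂ λ x y → IsDistance x y D) ×
    (∀ x y d → IsDistance x y d → d ≤ D)

  IsDominating : Subset n → List (Fin n) → Set
  IsDominating S p = ∀ v → v ∈ S → Any (λ u → v ∈ N[ u ]) p

  IsDominatingPair : Subset n → Fin n → Fin n → Set
  IsDominatingPair S x y =
    x ∈ S × y ∈ S × (∀ p → IsPath S x y p → IsDominating S p)

  IsDPGraph : Set
  IsDPGraph = ∀ S → Connected S → ∃₂ (IsDominatingPair S)

  IsExtremity : Fin n → Set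
  IsExtremity v = AtMostOneComponent (∁ N[ v ])

  IsIndependent : Subset n → Set
  IsIndependent I = ∀ x y → x ∈ I → y ∈ I → ¬ x ~ y

  -- The empty set counts as a module.  It is never a maximal strong
  -- module when n ≥ 2, since singletons are strong modules.
  IsModule : Subset n → Set
  IsModule M = ∀ x y → x ∈ M → y ∈ M → N x ─ M ≡ N y ─ M

  IsStrongModule : Subset n → Set
  IsStrongModule M =
    IsModule M ×
    (∀ M′ → IsModule M′ → M ⊆ M′ ⊎ M′ ⊆ M ⊎ Empty (M ∩ M′))

  IsMaximalStrongModule : Subset n → Set
  IsMaximalStrongModule M =
    IsStrongModule M × M ≢ full ×
    (∀ M′ → IsStrongModule M′ → M′ ≢ full → M ⊆ M′ → M′ ≡ M)

infix 4 _≟ˢ_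
_≟ˢ_ : ∀ {n} → DecidableEquality (Subset n)
_≟ˢ_ = ≡-dec _≟ᵇ_

allSubset? : ∀ {n} {P : U.Pred (Subset n) 0ℓ} → U.Decidable P → Dec (∀ S → P S)
allSubset? P? = map′
  (λ ¬∃ S → decidable-stable (P? S) (λ ¬p → ¬∃ (S , ¬p)))
  (λ ∀P (S , ¬p) → ¬p (∀P S))
  (¬? (anySubset? (λ S → ¬? (P? S))))

allSubsets : ∀ n → List (Subset n)
allSubsets zero    = [] ∷ []
allSubsets (suc n) =
  map (inside ∷_) (allSubsets n) ++ map (outside ∷_) (allSubsets n)

module _ {n : ℕ} (G : Graph n) where
  open Graph G

  isModule? : U.Decidable (IsModule G)
  isModule? M = all? λ x → all? λ y →
    (x ∈? M) →-dec ((y ∈? M) →-dec ((N x ─ M) ≟ˢ (N y ─ M)))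

  isStrongModule? : U.Decidable (IsStrongModule G)
  isStrongModule? M = isModule? M ×-dec allSubset? λ M′ →
    isModule? M′ →-dec
      ((M ⊆? M′) ⊎-dec ((M′ ⊆? M) ⊎-dec ¬? (nonempty? (M ∩ M′))))

  isMaximalStrongModule? : U.Decidable (IsMaximalStrongModule G)
  isMaximalStrongModule? M =
    isStrongModule? M ×-dec (¬? (M ≟ˢ full) ×-dec allSubset? λ M′ →
      isStrongModule? M′ →-dec
        (¬? (M′ ≟ˢ full) →-dec ((M ⊆? M′) →-dec (M′ ≟ˢ M))))

  maximalStrongModules : List (Subset n)
  maximalStrongModules = filter isMaximalStrongModule? (allSubsets n)

  moduleAt : Fin (length maximalStrongModules) → Subset n
  moduleAt = lookup maximalStrongModules

  quotient : Graph (length maximalStrongModules)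
  quotient = record
    { _~_      = λ i j → moduleAt i ≢ moduleAt j ×
                   (∀ x y → x ∈ moduleAt i → y ∈ moduleAt j → x ~ y)
    ; _~?_     = λ i j → ¬? (moduleAt i ≟ˢ moduleAt j) ×-dec
                   all? λ x → all? λ y →
                     (x ∈? moduleAt i) →-dec ((y ∈? moduleAt j) →-dec (x ~? y))
    ; ~-sym    = λ (M≢M′ , adj) →
                   (λ eq → M≢M′ (sym eq)) ,
                   (λ x y x∈ y∈ → ~-sym (adj y x y∈ x∈))
    ; ~-irrefl = λ { refl (M≢M , _) → M≢M refl }
    }

  Ext : ℕ → Set
  Ext α = ConnectedGraph G ×
    (∀ I → IsIndependent quotient I → (∀ v → v ∈ I → IsExtremity quotient v) →
      ∣ I ∣ ≤ α)

-- Let T be a set of representatives of the maximal strong modules; G[T] is the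
-- quotient graph.  It has a dominating pair x, y and still has diameter ≥ 6.
-- An extremity e has x or y in N[e], since otherwise x and y would be joined
-- in G[T] ∖ N[e] by a path that does not dominate e.  So among three
-- nonadjacent extremities two, u and v, are near the same end, say x.  Since
-- walks from x to y dominate, some z near y has distance ≥ 5 from x.  Let A be
-- the union of the shortest paths from u to z avoiding N[v], let B be that of
-- the ones from v to z avoiding N[u], and S = A ∪ B.  Removing N[u], N[v] or
-- N[z] leaves S connected: for u and v because z remains, for z because the
-- walk x, A, y dominates the vertices of B at distance 2 from x, so A and B
-- are linked away from z.  Hence a dominating pair of G[S] has an end in each
-- of N[u], N[v], N[z], but these are pairwise disjoint in S.

module Submission where

open import Defs
open import Data.Empty using (⊥)
open import Data.Fin using (Fin; zero; suc; _≟_)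
open import Data.Fin.Properties using (any?; suc-injective)
open import Data.Fin.Subset
  using (Subset; inside; outside; _∈_; _∉_; _⊆_; _⊂_; _∩_; ∁; ⁅_⁆; ∣_∣; Nonempty; Empty)
  renaming (⊤ to full)
open import Data.Fin.Subset.Properties
  using (_∈?_; _⊆?_; nonempty?; anySubset?; ∈⊤; ⊆-antisym; x∈⁅x⁆; x∈⁅y⁆⇒x≡y; x∈p∪q⁺; x∈p∪q⁻;
         x∈p∩q⁺; x∈p∩q⁻; x∈p∧x∉q⇒x∈p─q; p─q⊆p; x∉p⇒x∈∁p; x∈∁p⇒x∉p; ⊆⊤; p⊂q⇒∣p∣<∣q∣; ∣p∣≤n)
open import Data.List using (List; []; _∷_; map; length; lookup)
open import Data.List.Membership.Propositional using () renaming (_∈_ to _∈ˡ_)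
open import Data.List.Membership.Propositional.Properties
  using (∈-map⁺; ∈-map⁻; ∈-++⁺ˡ; ∈-++⁺ʳ; ∈-filter⁺; ∈-filter⁻; ∈-lookup)
import Data.List.Membership.DecPropositional as DecMembership
open import Data.List.Properties using (length-map)
open import Data.List.Relation.Unary.All using (All; []; _∷_)
import Data.List.Relation.Unary.All as All
import Data.List.Relation.Unary.All.Properties as All
open import Data.List.Relation.Unary.AllPairs using ([]; _∷_)
open import Data.List.Relation.Unary.Any using (Any; here; there; index)
open import Data.List.Relation.Unary.Any.Properties using (lookup-index)
open import Data.List.Relation.Unary.Linked using ([-]; _∷_)
open import Data.List.Relation.Unary.Unique.Propositional using (Unique)
open import Data.List.Relation.Unary.Unique.Propositional.Properties
  using (map⁺; ++⁺; filter⁺)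
open import Data.Nat using (ℕ; zero; suc; _+_; _∸_; _≤_; _<_; z≤n; s≤s; _≤?_)
open import Data.Nat.Induction using (<-wellFounded)
open import Data.Nat.Properties
  using (≤-refl; ≤-trans; ≤-reflexive; ≤-<-trans; +-comm; +-suc; +-identityʳ;
         m≤m+n; m≤n+m; m≤n⇒m≤1+n; +-mono-≤; +-monoˡ-≤; +-monoʳ-≤; ≮⇒≥; ≰⇒>; <⇒≱; 1+n≰n;
         anyUpTo?; ∸-monoʳ-<; pred-mono-≤)
  renaming (_≟_ to _≟ℕ_)
open import Data.Product using (∃; ∃₂; _×_; _,_; proj₁; proj₂)
open import Data.Sum using (_⊎_; inj₁; inj₂; [_,_])
open import Data.Vec using ([]; _∷_; tabulate; here; there)
open import Data.Vec.Properties using (lookup⇒[]=; []=⇒lookup; lookup∘tabulate; ∷-injectiveʳ)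
open import Function using (_∘_; id; case_of_)
open import Induction.WellFounded using (Acc; acc)
open import Level using (0ℓ)
open import Relation.Binary.PropositionalEquality
  using (_≡_; _≢_; refl; sym; trans; cong; subst)
open import Relation.Nullary using (Dec; yes; no; does; ¬_; contradiction)
open import Relation.Nullary.Decidable using (map′; ¬?; _×-dec_; _⊎-dec_;
         dec-true; decidable-stable)
import Relation.Unary as U

-- Subsets from decidable predicates, and a pigeonhole principle.

module _ {n : ℕ} {P : U.Pred (Fin n) 0ℓ} (P? : U.Decidable P) where

  ∈-tabulate⁺ : ∀ {x} → P x → x ∈ tabulate (does ∘ P?)
  ∈-tabulate⁺ {x} px = lookup⇒[]= x _
    (trans (lookup∘tabulate (does ∘ P?) x) (dec-true (P? x) px))

  ∈-tabulate⁻ : ∀ {x} → x ∈ tabulate (does ∘ P?) → P x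
  ∈-tabulate⁻ {x} x∈ with P? x | trans (sym (lookup∘tabulate (does ∘ P?) x)) ([]=⇒lookup x∈)
  ... | yes px | _  = px
  ... | no _   | ()

-- `Aᵢ` and `Bᵢ` are to say that the `i`-th of three vertices is near the first or the second vertex
-- of a dominating pair.
pigeonhole : ∀ {A₁ A₂ A₃ B₁ B₂ B₃ : Set} → A₁ ⊎ B₁ → A₂ ⊎ B₂ → A₃ ⊎ B₃ →
             ¬ (A₁ × A₂) → ¬ (A₁ × A₃) → ¬ (A₂ × A₃) →
             ¬ (B₁ × B₂) → ¬ (B₁ × B₃) → ¬ (B₂ × B₃) → ⊥
pigeonhole (inj₁ a) (inj₁ b) _        ¬aa _ _ _ _ _ = ¬aa (a , b)
pigeonhole (inj₁ a) (inj₂ _) (inj₁ c) _ ¬aa _ _ _ _ = ¬aa (a , c)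
pigeonhole (inj₁ _) (inj₂ b) (inj₂ c) _ _ _ _ _ ¬bb = ¬bb (b , c)
pigeonhole (inj₂ _) (inj₁ b) (inj₁ c) _ _ ¬aa _ _ _ = ¬aa (b , c)
pigeonhole (inj₂ a) (inj₁ _) (inj₂ c) _ _ _ _ ¬bb _ = ¬bb (a , c)
pigeonhole (inj₂ a) (inj₂ b) _        _ _ _ ¬bb _ _ = ¬bb (a , b)

-- Walks inside a set of vertices.

module Walks {n : ℕ} (G : Graph n) where
  open Graph G
  open DecMembership (_≟_ {n}) using () renaming (_∈?_ to _∈ˡ?_)

  Vertices : Set₁
  Vertices = U.Pred (Fin n) 0ℓ

  data Near (x y : Fin n) : Set where
    equal : x ≡ y → Near x y
    adj   : x ~ y → Near x y

  near-sym : ∀ {x y} → Near x y → Near y x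
  near-sym (equal eq) = equal (sym eq)
  near-sym (adj e)    = adj (~-sym e)

  near? : ∀ x y → Dec (Near x y)
  near? x y = map′ [ equal , adj ] (λ { (equal eq) → inj₁ eq ; (adj e) → inj₂ e })
                   ((x ≟ y) ⊎-dec (x ~? y))

  Far : Fin n → Vertices
  Far x = U.∁ (Near x)

  N[]⇒near : ∀ {x y} → y ∈ N[ x ] → Near x y
  N[]⇒near {x} y∈ with x∈p∪q⁻ (N x) ⁅ x ⁆ y∈
  ... | inj₁ y∈N = adj (∈-tabulate⁻ (x ~?_) y∈N)
  ... | inj₂ y∈x = equal (sym (x∈⁅y⁆⇒x≡y x y∈x))

  near⇒N[] : ∀ {x y} → Near x y → y ∈ N[ x ]
  near⇒N[] {x} (equal refl) = x∈p∪q⁺ (inj₂ (x∈⁅x⁆ x))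
  near⇒N[] {x} (adj e)      = x∈p∪q⁺ (inj₁ (∈-tabulate⁺ (x ~?_) e))

  -- Vertices may repeat, so that walks can be concatenated and reversed freely; `walk⇒path` removes
  -- the repetitions when a path is required.
  data Walk (P : Vertices) : ℕ → Fin n → Fin n → Set where
    here : ∀ {x} → P x → Walk P 0 x x
    step : ∀ {k x y z} → P x → x ~ y → Walk P k y z → Walk P (suc k) x z

  Joined : Vertices → Fin n → Fin n → Set
  Joined P x y = ∃ λ k → Walk P k x y

  -- An upper bound on the distance inside `P`. A bound composes well with `Near`, which stands for
  -- zero or one edge.
  Within : Vertices → ℕ → Fin n → Fin n → Set
  Within P k x y = ∃ λ l → l ≤ k × Walk P l x y

  Conn : Vertices → Set
  Conn P = ∀ {x y} → P x → P y → Joined P x y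

  module _ {P Q : Vertices} (P⊆Q : P U.⊆ Q) where

    mapʷ : ∀ {k x y} → Walk P k x y → Walk Q k x y
    mapʷ (here p)     = here (P⊆Q p)
    mapʷ (step p e w) = step (P⊆Q p) e (mapʷ w)

    mapʲ : ∀ {x y} → Joined P x y → Joined Q x y
    mapʲ (k , w) = k , mapʷ w

  module _ {P : Vertices} where

    start : ∀ {k x y} → Walk P k x y → P x
    start (here p)     = p
    start (step p _ _) = p

    end : ∀ {k x y} → Walk P k x y → P y
    end (here p)     = p
    end (step _ _ w) = end w

    _++ʷ_ : ∀ {k l x y z} → Walk P k x y → Walk P l y z → Walk P (k + l) x z
    here _     ++ʷ w′ = w′
    step p e w ++ʷ w′ = step p e (w ++ʷ w′)

    snoc : ∀ {k x y z} → Walk P k x y → y ~ z → P z → Walk P (suc k) x z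
    snoc (here p)     e pz = step p e (here pz)
    snoc (step p f w) e pz = step p f (snoc w e pz)

    reverse : ∀ {k x y} → Walk P k x y → Walk P k y x
    reverse (here p)     = here p
    reverse (step p e w) = snoc (reverse w) (~-sym e) p

    symʲ : ∀ {x y} → Joined P x y → Joined P y x
    symʲ (k , w) = k , reverse w

    transʲ : ∀ {x y z} → Joined P x y → Joined P y z → Joined P x z
    transʲ (k , w) (l , w′) = k + l , w ++ʷ w′

    conn-via : ∀ h → (∀ {x} → P x → Joined P x h) → Conn P
    conn-via h toHub px py = transʲ (toHub px) (symʲ (toHub py))

    nearʷ : ∀ {x y} → P x → P y → Near x y → Within P 1 x y
    nearʷ px _  (equal refl) = 0 , z≤n , here px
    nearʷ px py (adj e)      = 1 , ≤-refl , step px e (here py)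

    nearʲ : ∀ {x y} → P x → P y → Near x y → Joined P x y
    nearʲ px py x≈y with nearʷ px py x≈y
    ... | k , _ , w = k , w

    _++ⁱ_ : ∀ {k l x y z} → Within P k x y → Within P l y z → Within P (k + l) x z
    (i , i≤k , w) ++ⁱ (j , j≤l , w′) = i + j , +-mono-≤ i≤k j≤l , w ++ʷ w′

    symⁱ : ∀ {k x y} → Within P k x y → Within P k y x
    symⁱ (i , i≤k , w) = i , i≤k , reverse w

    walk⇒within : ∀ {k x y} → Walk P k x y → Within P k x y
    walk⇒within w = _ , ≤-refl , w

    weaken : ∀ {k l x y} → k ≤ l → Within P k x y → Within P l x y
    weaken k≤l (i , i≤k , w) = i , ≤-trans i≤k k≤l , w

    walk₀ : ∀ {x y} → Walk P 0 x y → x ≡ y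
    walk₀ (here _) = refl

    crossing : ∀ {C : Vertices} → U.Decidable C → ∀ {k x y} → Walk P k x y → C x → ¬ C y →
               ∃₂ λ p q → P p × P q × p ~ q × C p × ¬ C q
    crossing C? (here _) cx ¬cx = contradiction cx ¬cx
    crossing C? (step {x = x} {y} px e w) cx ¬cz with C? y
    ... | yes cy = crossing C? w cy ¬cz
    ... | no ¬cy = x , y , px , start w , e , cx , ¬cy

    module _ (P? : U.Decidable P) where

      walk? : ∀ k x y → Dec (Walk P k x y)
      walk? zero x y =
        map′ (λ { (px , refl) → here px }) (λ { (here px) → px , refl }) (P? x ×-dec (x ≟ y))
      walk? (suc k) x y =
        map′ (λ { (px , z , e , w) → step px e w }) (λ { (step px e w) → px , _ , e , w })
             (P? x ×-dec any? λ z → (x ~? z) ×-dec walk? k z y)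

      within? : ∀ k x y → Dec (Within P k x y)
      within? k x y =
        map′ (λ { (l , s≤s l≤k , w) → l , l≤k , w }) (λ { (l , l≤k , w) → l , s≤s l≤k , w })
             (anyUpTo? (λ l → walk? l x y) (suc k))

  -- Geodesics and intervals.

  Shortest : Vertices → ℕ → Fin n → Fin n → Set
  Shortest P k x y = Walk P k x y × (∀ {l} → Walk P l x y → k ≤ l)

  shortest : ∀ {P} → U.Decidable P → ∀ {x y} → Joined P x y → ∃ λ k → Shortest P k x y
  shortest {P} P? {x} {y} (k , w) = go w (<-wellFounded k)
    where
    go : ∀ {k} → Walk P k x y → Acc _<_ k → ∃ λ l → Shortest P l x y
    go {k} w (acc rs) with anyUpTo? (λ l → walk? P? l x y) k
    ... | yes (l , l<k , w′) = go w′ (rs l<k)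
    ... | no shorter         = k , w , λ {l} w′ → ≮⇒≥ λ l<k → shorter (l , l<k , w′)

  -- When the distance from x to y inside P is k, the vertices on geodesics
  -- whose distance from x is at least m.
  IntervalFrom : ℕ → Vertices → ℕ → Fin n → Fin n → Vertices
  IntervalFrom m P k x y q = ∃₂ λ i j → m ≤ i × i + j ≡ k × Walk P i x q × Walk P j q y

  Interval : Vertices → ℕ → Fin n → Fin n → Vertices
  Interval = IntervalFrom 0

  module _ {P : Vertices} where

    interval? : U.Decidable P → ∀ k x y → U.Decidable (Interval P k x y)
    interval? P? k x y q =
      map′ (λ { (i , _ , j , _ , eq , w , w′) → i , j , z≤n , eq , w , w′ })
           (λ { (i , j , _ , eq , w , w′) →
                i , s≤s (≤-trans (m≤m+n i j) (≤-reflexive eq)) ,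
                j , s≤s (≤-trans (m≤n+m j i) (≤-reflexive eq)) , eq , w , w′ })
           (anyUpTo? (λ i → anyUpTo? (λ j →
             (i + j ≟ℕ k) ×-dec (walk? P? i x q ×-dec walk? P? j q y)) (suc k)) (suc k))

    interval⊆ : ∀ {m k x y} → IntervalFrom m P k x y U.⊆ P
    interval⊆ (_ , _ , _ , _ , w , _) = end w

    interval-sym : ∀ {k x y} → Interval P k x y U.⊆ Interval P k y x
    interval-sym (i , j , _ , eq , w , w′) =
      j , i , z≤n , trans (+-comm j i) eq , reverse w′ , reverse w

    interval-start : ∀ {k x y} → Walk P k x y → Interval P k x y x
    interval-start w = 0 , _ , z≤n , refl , here (start w) , w

    interval-end : ∀ {k x y} → Walk P k x y → Interval P k x y y
    interval-end w = _ , 0 , z≤n , +-identityʳ _ , w , here (end w)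

    -- The second walk itself serves: each of its edges raises `i` and lowers `j` by one, which
    -- preserves both `i + j ≡ k` and `m ≤ i`.
    toEnd : ∀ {m i j k x q y} → m ≤ i → i + j ≡ k → Walk P i x q → Walk P j q y →
            Joined (IntervalFrom m P k x y) q y
    toEnd {i = i} m≤i eq w (here p) = 0 , here (i , 0 , m≤i , eq , w , here p)
    toEnd {i = i} {suc j} m≤i eq w (step p e w′)
      with toEnd (m≤n⇒m≤1+n m≤i) (trans (sym (+-suc i j)) eq) (snoc w e (start w′)) w′
    ... | l , v = suc l , step (i , suc j , m≤i , eq , w , step p e w′) e v

    interval⇒end : ∀ {k x y q} → Interval P k x y q → Joined (Interval P k x y) q y
    interval⇒end (_ , _ , _ , eq , w , w′) = toEnd z≤n eq w w′

    module _ {k x y} (geodesic : Shortest P k x y) where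

      -- If `q` were near `x`, at most one edge could replace the initial segment of at least two,
      -- giving a walk shorter than the geodesic.
      beyond⊆far : IntervalFrom 2 P k x y U.⊆ (Interval P k x y U.∩ Far x)
      beyond⊆far (i , j , 2≤i , eq , w , w′) = (i , j , z≤n , eq , w , w′) , λ near →
        case nearʷ (start w) (end w) near of λ { (l , l≤1 , v) →
          <⇒≱ (≤-<-trans (≤-trans (proj₂ geodesic (v ++ʷ w′)) (+-monoˡ-≤ j l≤1)) (+-monoˡ-≤ j 2≤i))
              (≤-reflexive eq) }

      -- Positions 0 and 1 on a geodesic are near `x`, so a far vertex has position at least 2.
      -- Moving on towards `y` never lowers the position, and `beyond⊆far` applies all the way.
      far⇒end : ∀ {q} → (Interval P k x y U.∩ Far x) q →
                Joined (Interval P k x y U.∩ Far x) q y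
      far⇒end ((zero , _ , _ , _ , w , _) , far) = contradiction (equal (walk₀ w)) far
      far⇒end ((suc zero , _ , _ , _ , step _ e (here _) , _) , far) = contradiction (adj e) far
      far⇒end ((suc (suc i) , j , _ , eq , w , w′) , _) =
        mapʲ beyond⊆far (toEnd (s≤s (s≤s z≤n)) eq w w′)

    shortest-sym : ∀ {k x y} → Shortest P k x y → Shortest P k y x
    shortest-sym (w , min) = reverse w , min ∘ reverse

    far⇒start : ∀ {k x y q} → Shortest P k x y → (Interval P k x y U.∩ Far y) q →
                Joined (Interval P k x y U.∩ Far y) q x
    far⇒start s (i , far) =
      mapʲ (λ (i , f) → interval-sym i , f) (far⇒end (shortest-sym s) (interval-sym i , far))

  -- Conversion between walks and paths.

  suffix : ∀ {S x y z p} {P : Vertices} → x ∈ˡ p → IsPath G S y z p → All P p →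
           ∃ λ p′ → IsPath G S x z p′ × All P p′ × length p′ ≤ length p
  suffix {p = c ∷ p} (here refl) path ps =
    c ∷ p , record { starts = refl ; ends = ends ; linked = linked
                   ; unique = unique ; within = within } , ps , ≤-refl
    where open IsPath path
  suffix {p = c ∷ d ∷ p} (there x∈) path (_ ∷ ps) with path
  ... | record { ends = ends ; linked = _ ∷ linked ; unique = _ ∷ unique ; within = _ ∷ within }
    with suffix x∈ (record { starts = refl ; ends = ends ; linked = linked
                           ; unique = unique ; within = within }) ps
  ... | p′ , path′ , ps′ , shorter = p′ , path′ , ps′ , m≤n⇒m≤1+n shorter

  -- If `x` already occurs on the path built from the tail, that path is cut at `x`; otherwise `x`
  -- is put in front. `All P p` is recorded besides membership in `S` because `P` may be smaller,
  -- and a dominating vertex is later wanted in `P`.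
  walk⇒path : ∀ {S P k x y} → (∀ {q} → P q → q ∈ S) → Walk P k x y →
              ∃ λ p → IsPath G S x y p × All P p × length p ≤ suc k
  walk⇒path {x = x} P⊆S (here px) =
    x ∷ [] , record { starts = refl ; ends = refl ; linked = [-]
                    ; unique = [] ∷ [] ; within = P⊆S px ∷ [] } , px ∷ [] , ≤-refl
  walk⇒path {x = x} P⊆S (step px e w) with walk⇒path P⊆S w
  ... | p , path , ps , short with x ∈ˡ? p
  ...   | yes x∈p = let p′ , path′ , ps′ , shorter = suffix x∈p path ps in
                    p′ , path′ , ps′ , ≤-trans shorter (m≤n⇒m≤1+n short)
  walk⇒path {x = x} P⊆S (step px e w)
      | [] , record { starts = () } , _ | _
  walk⇒path {x = x} P⊆S (step px e w)
      | c ∷ p , record { starts = refl ; ends = ends ; linked = linked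
                       ; unique = unique ; within = within } , ps , short
      | no x∉p =
    x ∷ c ∷ p , record { starts = refl ; ends = ends ; linked = e ∷ linked
                       ; unique = All.¬Any⇒All¬ _ x∉p ∷ unique
                       ; within = P⊆S px ∷ within } , px ∷ ps , s≤s short

  path⇒joined : ∀ {S x y p} → IsPath G S x y p → Joined (_∈ S) x y
  path⇒joined {p = _ ∷ []} record { starts = refl ; ends = refl ; within = x∈ ∷ [] } =
    0 , here x∈
  path⇒joined {p = _ ∷ _ ∷ _}
      record { starts = refl ; ends = ends ; linked = e ∷ linked
             ; unique = _ ∷ unique ; within = x∈ ∷ within }
    with path⇒joined record { starts = refl ; ends = ends ; linked = linked
                            ; unique = unique ; within = within }
  ... | k , w = suc k , step x∈ e w

  -- Domination by walks.

  -- The dominating pair condition with paths replaced by any set `P` that contains a walk between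
  -- the two vertices. Choosing `P` small locates the dominating vertex.
  Dominates : Vertices → Fin n → Fin n → Set₁
  Dominates S x y = ∀ {P} → P U.⊆ S → Joined P x y → ∀ {v} → S v → ∃ λ q → P q × Near q v

  dominates-sym : ∀ {S x y} → Dominates S x y → Dominates S y x
  dominates-sym dom P⊆S = dom P⊆S ∘ symʲ

  -- Otherwise S ∖ N[ e ] would contain a walk from x to y that misses e.
  near-end : ∀ {S x y} → S x → S y → Dominates S x y → ∀ {e} → S e → Conn (S U.∩ Far e) →
             Near e x ⊎ Near e y
  near-end {x = x} {y} sx sy dom {e} se conn with near? e x | near? e y
  ... | yes e≈x | _       = inj₁ e≈x
  ... | no _    | yes e≈y = inj₂ e≈y
  ... | no e≉x  | no e≉y  =
    let q , (_ , e≉q) , q≈e = dom proj₁ (conn (sx , e≉x) (sy , e≉y)) se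
    in contradiction (near-sym q≈e) e≉q

  -- The smallest choice of `P` in `Dominates`: the dominating vertex then lies on the given walk.
  On : ∀ {P k x y} → Walk P k x y → Vertices
  On (here {x} _)         q = q ≡ x
  On (step {x = x} _ _ w) q = q ≡ x ⊎ On w q

  on⊆ : ∀ {P k x y} (w : Walk P k x y) → On w U.⊆ P
  on⊆ (here p)     refl        = p
  on⊆ (step p _ _) (inj₁ refl) = p
  on⊆ (step _ _ w) (inj₂ on)   = on⊆ w on

  on-walk : ∀ {P k x y} (w : Walk P k x y) → Walk (On w) k x y
  on-walk (here _)     = here refl
  on-walk (step _ e w) = step (inj₁ refl) e (mapʷ inj₂ (on-walk w))

  InOrder : Vertices → ℕ → Fin n → Fin n → Fin n → Fin n → Set
  InOrder P k x p q y = ∃₂ λ i m → ∃ λ j → i + (m + j) ≡ k ×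
                        Walk P i x p × Walk P m p q × Walk P j q y

  split : ∀ {P k x y} (w : Walk P k x y) {q} → On w q →
          ∃₂ λ i j → i + j ≡ k × Walk P i x q × Walk P j q y
  split (here p)       refl        = 0 , 0 , refl , here p , here p
  split w@(step p _ _) (inj₁ refl) = 0 , _ , refl , here p , w
  split (step p e w)   (inj₂ on)   =
    let i , j , eq , w₁ , w₂ = split w on in suc i , j , cong suc eq , step p e w₁ , w₂

  split₂ : ∀ {P k x y} (w : Walk P k x y) {p q} → On w p → On w q →
           InOrder P k x p q y ⊎ InOrder P k x q p y
  split₂ w@(here px) refl on =
    inj₁ (0 , let i , j , eq , w₁ , w₂ = split w on in i , j , eq , here px , w₁ , w₂)
  split₂ w@(step px _ _) (inj₁ refl) on =
    inj₁ (0 , let i , j , eq , w₁ , w₂ = split w on in i , j , eq , here px , w₁ , w₂)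
  split₂ w@(step px _ _) on@(inj₂ _) (inj₁ refl) =
    inj₂ (0 , let i , j , eq , w₁ , w₂ = split w on in i , j , eq , here px , w₁ , w₂)
  split₂ (step px e w) (inj₂ on) (inj₂ on′) with split₂ w on on′
  ... | inj₁ (i , m , j , eq , w₁ , w₂ , w₃) =
    inj₁ (suc i , m , j , cong suc eq , step px e w₁ , w₂ , w₃)
  ... | inj₂ (i , m , j , eq , w₁ , w₂ , w₃) =
    inj₂ (suc i , m , j , cong suc eq , step px e w₁ , w₂ , w₃)

  module _ {T : Vertices} {x y : Fin n} where

    -- A walk of length ≤ 4 can dominate two vertices at distance ≥ 6 only if
    -- one is near its start and the other near its end.
    far-from-start : ∀ {a b p q k} → T a → T b → ¬ Within T 5 a b → k ≤ 4 →
                     InOrder T k x p q y → Near p a → Near q b → ¬ Within T 4 x b × Near b y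
    far-from-start {a} {b} ta tb a≁b k≤4 (i , m , j , eq , w₁ , w₂ , w₃) p≈a q≈b
      with m ≤? 3
    ... | yes m≤3 = contradiction (weaken (+-monoʳ-≤ 1 (+-monoˡ-≤ 1 m≤3)) chain) a≁b
      where
      chain : Within T (1 + (m + 1)) a b
      chain = nearʷ ta (start w₂) (near-sym p≈a) ++ⁱ (walk⇒within w₂ ++ⁱ nearʷ (end w₂) tb q≈b)
    -- Now `m` is at least 4, and `k ≤ 4` forces `i` and `j` to be 0, so `p` is `x` and `q` is `y`.
    -- As `a` is near `x`, a walk of length at most 4 from `x` to `b` would bring `a` within 5 of
    -- `b`.
    far-from-start ta tb a≁b k≤4 (zero , m , zero , _ , w₁ , w₂ , w₃) p≈a q≈b | no _
      with refl ← walk₀ w₁ | refl ← walk₀ w₃ =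
      (λ xb → a≁b (nearʷ ta (start w₂) (near-sym p≈a) ++ⁱ xb)) , near-sym q≈b
    far-from-start ta tb a≁b k≤4 (suc i , m , j , refl , w₁ , w₂ , w₃) p≈a q≈b | no m≰3 =
      contradiction (≤-trans (s≤s (≤-trans (≰⇒> m≰3) (≤-trans (m≤m+n m j) (m≤n+m (m + j) i)))) k≤4)
                    1+n≰n
    far-from-start ta tb a≁b k≤4 (zero , m , suc j , refl , w₁ , w₂ , w₃) p≈a q≈b | no m≰3 =
      contradiction (≤-trans (≤-trans (s≤s (≤-trans (≰⇒> m≰3) (m≤m+n m j)))
                                      (≤-reflexive (sym (+-suc m j)))) k≤4)
                    1+n≰n

    -- Either `y` itself is far enough from `x`, or a walk of length at most 4 joins them. The
    -- latter must dominate both `a` and `b`, and whichever is dominated later along it serves as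
    -- `z`.
    far-point : U.Decidable T → T y → Dominates T x y → ∀ {a b} → T a → T b → ¬ Within T 5 a b →
                ∃ λ z → T z × ¬ Within T 4 x z × Near z y
    far-point T? ty dom {a} {b} ta tb a≁b with within? T? 4 x y
    ... | no x≁y = y , ty , x≁y , equal refl
    ... | yes (k , k≤4 , w)
      with p , on-p , p≈a ← dom (on⊆ w) (k , on-walk w) ta
         | q , on-q , q≈b ← dom (on⊆ w) (k , on-walk w) tb
      with split₂ w on-p on-q
    ... | inj₁ pq = b , tb , far-from-start ta tb a≁b k≤4 pq p≈a q≈b
    ... | inj₂ qp = a , ta , far-from-start tb ta (a≁b ∘ symⁱ) k≤4 qp q≈b p≈a

  -- Dominating pairs and extremities near a common end.

  module _ (dp : IsDPGraph G) where

    dominatingPair : ∀ {S} → U.Decidable S → ∃ S → Conn S →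
                     ∃₂ λ x y → S x × S y × Dominates S x y
    dominatingPair {S} S? (s , ss) conn =
      let x , y , x∈ , y∈ , dom = dp (tabulate (does ∘ S?))
            ((s , ∈-tabulate⁺ S? ss) , λ x y x∈ y∈ →
              let _ , w = conn (∈-tabulate⁻ S? x∈) (∈-tabulate⁻ S? y∈)
                  p , path , _ = walk⇒path (∈-tabulate⁺ S?) w
              in p , path)
      in x , y , ∈-tabulate⁻ S? x∈ , ∈-tabulate⁻ S? y∈ , dominates dom
      where
      search : ∀ {P : Vertices} {v p} → All P p → Any (λ u → v ∈ N[ u ]) p → ∃ λ q → P q × Near q v
      search (px ∷ _)  (here v∈)   = _ , px , N[]⇒near v∈
      search (_ ∷ pxs) (there any) = search pxs any

      dominates : ∀ {x y} →
                  (∀ p → IsPath G (tabulate (does ∘ S?)) x y p →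
                   IsDominating G (tabulate (does ∘ S?)) p) →
                  Dominates S x y
      dominates dom P⊆S (_ , w) sv =
        let p , path , ps , _ = walk⇒path (∈-tabulate⁺ S? ∘ P⊆S) w
        in search ps (dom p path _ (∈-tabulate⁺ S? sv))

    module _ {T : Vertices} (T? : U.Decidable T) where

      no-common-neighbour :
        ∀ {x y} → T x → T y → Dominates T x y →
        ∀ {z} → T z → ¬ Within T 4 x z → Near z y →
        ∀ {u v} → T u → T v → ¬ Near u v → Conn (T U.∩ Far u) → Conn (T U.∩ Far v) →
        ¬ (Near u x × Near v x)
      no-common-neighbour {x} {y} tx ty dom {z} tz x≁z z≈y {u} {v} tu tv u≉v
                          conn-u conn-v (u≈x , v≈x) =
        no-dominating-pair (dominatingPair S? (z , inj₁ Az) (conn-via z S⇒z))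
        where
        x≈u : Near x u
        x≈u = near-sym u≈x

        x≈v : Near x v
        x≈v = near-sym v≈x

        -- One more edge, from `p` to `z`, would make 4, the length excluded by `x≁z`. Every
        -- separation from `z` below comes from this bound.
        far-z : ∀ {p} → Within T 3 x p → T p → Far z p
        far-z xp tp z≈p = x≁z (xp ++ⁱ nearʷ tp tz (near-sym z≈p))

        side : ∀ {s} → T s → Near x s → Far s z
        side ts x≈s s≈z = far-z (weaken (s≤s z≤n) (nearʷ tx ts x≈s)) ts (near-sym s≈z)

        TA TB : Vertices
        TA = T U.∩ Far v
        TB = T U.∩ Far u

        TA? : U.Decidable TA
        TA? q = T? q ×-dec ¬? (near? v q)

        TB? : U.Decidable TB
        TB? q = T? q ×-dec ¬? (near? u q)

        geodesic-A : ∃ λ k → Shortest TA k u z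
        -- As `v` is an extremity, `u` and `z`, both outside `N[ v ]`, are joined there.
        geodesic-A = shortest TA? (conn-v (tu , u≉v ∘ near-sym) (tz , side tv x≈v))

        geodesic-B : ∃ λ k → Shortest TB k v z
        geodesic-B = shortest TB? (conn-u (tv , u≉v) (tz , side tu x≈u))

        shortest-A = proj₂ geodesic-A
        shortest-B = proj₂ geodesic-B

        A B S : Vertices
        A = Interval TA (proj₁ geodesic-A) u z
        B = Interval TB (proj₁ geodesic-B) v z
        S = A U.∪ B

        S? : U.Decidable S
        S? q = interval? TA? _ u z q ⊎-dec interval? TB? _ v z q

        A⊆ : A U.⊆ TA
        A⊆ = interval⊆

        B⊆ : B U.⊆ TB
        B⊆ = interval⊆

        Au : A u
        Au = interval-start (proj₁ shortest-A)

        Az : A z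
        Az = interval-end (proj₁ shortest-A)

        Bv : B v
        Bv = interval-start (proj₁ shortest-B)

        S⊆T : S U.⊆ T
        S⊆T (inj₁ a) = proj₁ (A⊆ a)
        S⊆T (inj₂ b) = proj₁ (B⊆ b)

        disjoint-uv : ∀ {c} → S c → ¬ (Near u c × Near v c)
        disjoint-uv (inj₁ a) (_ , v≈c) = proj₂ (A⊆ a) v≈c
        disjoint-uv (inj₂ b) (u≈c , _) = proj₂ (B⊆ b) u≈c

        -- A vertex near both `s` and `z` would be within 2 of `x`, too close to `x` to be near `z`.
        disjoint-z : ∀ {s} → T s → Near x s → ∀ {c} → S c → ¬ (Near s c × Near z c)
        disjoint-z ts x≈s sc (s≈c , z≈c) =
          far-z (weaken (s≤s (s≤s z≤n)) (nearʷ tx ts x≈s ++ⁱ nearʷ ts (S⊆T sc) s≈c)) (S⊆T sc) z≈c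

        -- `x` and `y` may lie outside `S`, so `Q` is compared with `T`, for which `x` and `y` are a
        -- dominating pair.
        Q : Vertices
        Q q = x ≡ q ⊎ y ≡ q ⊎ A q

        Q⊆T : Q U.⊆ T
        Q⊆T (inj₁ refl)        = tx
        Q⊆T (inj₂ (inj₁ refl)) = ty
        Q⊆T (inj₂ (inj₂ a))    = proj₁ (A⊆ a)

        x⇝y : Joined Q x y
        x⇝y = transʲ (nearʲ (inj₁ refl) (inj₂ (inj₂ Au)) x≈u)
                     (transʲ (mapʲ (inj₂ ∘ inj₂) (interval⇒end Au))
                             (nearʲ (inj₂ (inj₂ Az)) (inj₂ (inj₁ refl)) z≈y))

        -- The walk from x through A to y dominates each p ∈ B at distance 2
        -- from x, and neither x nor y can be the dominating vertex.
        dominated-by-A : ∀ {p} → T p → Within T 2 x p → ¬ Near x p →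
                         (∃ λ q → Q q × Near q p) → ∃ λ q → (A U.∩ Far z) q × Near q p
        dominated-by-A tp xp x≉p (_ , inj₁ refl , x≈p) = contradiction x≈p x≉p
        dominated-by-A tp xp x≉p (_ , inj₂ (inj₁ refl) , y≈p) =
          contradiction z≈y (far-z (xp ++ⁱ nearʷ tp ty (near-sym y≈p)) ty)
        dominated-by-A tp xp x≉p (q , inj₂ (inj₂ a) , q≈p) =
          q , (a , far-z (xp ++ⁱ nearʷ tp (proj₁ (A⊆ a)) (near-sym q≈p)) (proj₁ (A⊆ a))) , q≈p

        -- A walk in `B` from `v` to `z` starts in `N[ x ]` and ends outside; `p` is its first
        -- vertex outside, at distance exactly 2 from `x`. `Near` allows `p` and `q` to coincide,
        -- since `A` and `B` may meet.
        bridge : ∃₂ λ p q → (B U.∩ Far z) p × (A U.∩ Far z) q × Near q p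
        bridge =
          let p′ , p , Bp′ , Bp , p′~p , x≈p′ , x≉p =
                crossing (near? x) (proj₂ (interval⇒end Bv)) x≈v
                         (λ x≈z → x≁z (weaken (s≤s z≤n) (nearʷ tx tz x≈z)))
              tp′ = proj₁ (B⊆ Bp′)
              tp = proj₁ (B⊆ Bp)
              xp = nearʷ tx tp′ x≈p′ ++ⁱ nearʷ tp′ tp (adj p′~p)
              q , Aq , q≈p = dominated-by-A tp xp x≉p (dom Q⊆T x⇝y tp)
          in p , q , (Bp , far-z (weaken (s≤s (s≤s z≤n)) xp) tp) , Aq , q≈p

        S⇒z : ∀ {q} → S q → Joined S q z
        S⇒z (inj₁ a) = mapʲ inj₁ (interval⇒end a)
        S⇒z (inj₂ b) = mapʲ inj₂ (interval⇒end b)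

        -- On `A`, whose geodesics start at `u`, a vertex far from `u` moves on towards `z`; `B`
        -- avoids `N[ u ]` altogether.
        S∖u : Conn (S U.∩ Far u)
        S∖u = conn-via z λ where
          (inj₁ a , far) → mapʲ (λ (a , f) → inj₁ a , f) (far⇒end shortest-A (a , far))
          (inj₂ b , _)   → mapʲ (λ b → inj₂ b , proj₂ (B⊆ b)) (interval⇒end b)

        S∖v : Conn (S U.∩ Far v)
        S∖v = conn-via z λ where
          (inj₁ a , _)   → mapʲ (λ a → inj₁ a , proj₂ (A⊆ a)) (interval⇒end a)
          (inj₂ b , far) → mapʲ (λ (b , f) → inj₂ b , f) (far⇒end shortest-B (b , far))

        -- Geodesics are followed backwards here, so that the distance to `z` inside `TA` only
        -- grows.
        A∖z⇒u : ∀ {q} → (A U.∩ Far z) q → Joined (S U.∩ Far z) q u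
        A∖z⇒u a = mapʲ (λ (a , f) → inj₁ a , f) (far⇒start shortest-A a)

        B∖z⇒v : ∀ {q} → (B U.∩ Far z) q → Joined (S U.∩ Far z) q v
        B∖z⇒v b = mapʲ (λ (b , f) → inj₂ b , f) (far⇒start shortest-B b)

        cross : (∃₂ λ p q → (B U.∩ Far z) p × (A U.∩ Far z) q × Near q p) →
                Joined (S U.∩ Far z) v u
        cross (_ , _ , (Bp , p-far) , (Aq , q-far) , q≈p) =
          transʲ (symʲ (B∖z⇒v (Bp , p-far)))
                 (transʲ (nearʲ (inj₂ Bp , p-far) (inj₁ Aq , q-far) (near-sym q≈p))
                         (A∖z⇒u (Aq , q-far)))

        S∖z : Conn (S U.∩ Far z)
        S∖z = conn-via u λ where
          (inj₁ a , far) → A∖z⇒u (a , far)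
          (inj₂ b , far) → transʲ (B∖z⇒v (b , far)) (cross bridge)

        no-dominating-pair : ¬ ∃₂ λ a b → S a × S b × Dominates S a b
        no-dominating-pair (a , b , sa , sb , dom-ab) =
          pigeonhole (hits (inj₁ Au) S∖u) (hits (inj₂ Bv) S∖v) (hits (inj₁ Az) S∖z)
                     (disjoint-uv sa) (disjoint-z tu x≈u sa) (disjoint-z tv x≈v sa)
                     (disjoint-uv sb) (disjoint-z tu x≈u sb) (disjoint-z tv x≈v sb)
          where
          hits : ∀ {e} → S e → Conn (S U.∩ Far e) → Near e a ⊎ Near e b
          hits = near-end sa sb dom-ab

      no-three-extremities :
        Conn T → ∀ {a b} → T a → T b → ¬ Within T 5 a b →
        ∀ {u v w} → T u → T v → T w → ¬ Near u v → ¬ Near u w → ¬ Near v w →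
        Conn (T U.∩ Far u) → Conn (T U.∩ Far v) → Conn (T U.∩ Far w) → ⊥
      no-three-extremities conn ta tb a≁b tu tv tw u≉v u≉w v≉w conn-u conn-v conn-w =
        let x , y , tx , ty , dom = dominatingPair T? (_ , ta) conn
            z , tz , x≁z , z≈y = far-point T? ty dom ta tb a≁b
            -- The same with the pair reversed: a vertex near `x` and remote from `y`, for the
            -- extremities near `y`.
            z′ , tz′ , y≁z′ , z′≈x = far-point T? tx (dominates-sym dom) ta tb a≁b
            at-x : ∀ {s t} → T s → T t → ¬ Near s t → Conn (T U.∩ Far s) → Conn (T U.∩ Far t) →
                   ¬ (Near s x × Near t x)
            at-x = no-common-neighbour tx ty dom tz x≁z z≈y
            at-y : ∀ {s t} → T s → T t → ¬ Near s t → Conn (T U.∩ Far s) → Conn (T U.∩ Far t) →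
                   ¬ (Near s y × Near t y)
            at-y = no-common-neighbour ty tx (dominates-sym dom) tz′ y≁z′ z′≈x
            hits : ∀ {e} → T e → Conn (T U.∩ Far e) → Near e x ⊎ Near e y
            hits = near-end tx ty dom
        in pigeonhole (hits tu conn-u) (hits tv conn-v) (hits tw conn-w)
             (at-x tu tv u≉v conn-u conn-v) (at-x tu tw u≉w conn-u conn-w)
             (at-x tv tw v≉w conn-v conn-w)
             (at-y tu tv u≉v conn-u conn-v) (at-y tu tw u≉w conn-u conn-w)
             (at-y tv tw v≉w conn-v conn-w)

-- Enumeration of subsets and of their elements.

-- With `allSubsets-unique`, this makes distinct vertices of the quotient stand for distinct
-- modules.
lookup-injective : ∀ {A : Set} {xs : List A} → Unique xs → ∀ i j →
                   lookup xs i ≡ lookup xs j → i ≡ j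
lookup-injective (_ ∷ _)  zero    zero    _  = refl
lookup-injective (x∉ ∷ _) zero    (suc j) eq = contradiction eq (All.lookup x∉ (∈-lookup j))
lookup-injective (x∉ ∷ _) (suc i) zero    eq = contradiction (sym eq) (All.lookup x∉ (∈-lookup i))
lookup-injective (_ ∷ u)  (suc i) (suc j) eq = cong suc (lookup-injective u i j eq)

allSubsets-unique : ∀ n → Unique (allSubsets n)
allSubsets-unique zero    = [] ∷ []
allSubsets-unique (suc n) =
  ++⁺ (map⁺ ∷-injectiveʳ (allSubsets-unique n)) (map⁺ ∷-injectiveʳ (allSubsets-unique n)) disjoint
  where
  disjoint : ∀ {S} → ¬ (S ∈ˡ map (inside ∷_) (allSubsets n) × S ∈ˡ map (outside ∷_) (allSubsets n))
  disjoint (in₁ , in₂) with ∈-map⁻ (inside ∷_) in₁ | ∈-map⁻ (outside ∷_) in₂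
  ... | _ , _ , refl | _ , _ , ()

allSubsets-complete : ∀ {n} (S : Subset n) → S ∈ˡ allSubsets n
allSubsets-complete []            = here refl
allSubsets-complete (inside ∷ S)  = ∈-++⁺ˡ (∈-map⁺ (inside ∷_) (allSubsets-complete S))
allSubsets-complete {suc n} (outside ∷ S) =
  ∈-++⁺ʳ (map (inside ∷_) (allSubsets n)) (∈-map⁺ (outside ∷_) (allSubsets-complete S))

pick : ∀ {n} k (p : Subset n) → k ≤ ∣ p ∣ →
       ∃ λ xs → length xs ≡ k × Unique xs × All (_∈ p) xs
pick zero    p             _     = [] , refl , [] , []
pick (suc k) (inside ∷ p)  (s≤s k≤) with pick k p k≤
... | xs , len , unique , xs∈ =
  zero ∷ map suc xs , cong suc (trans (length-map suc xs) len) ,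
  All.map⁺ (All.tabulate λ _ ()) ∷ map⁺ suc-injective unique ,
  here ∷ All.map⁺ (All.map there xs∈)
pick (suc k) (outside ∷ p) k≤ with pick (suc k) p k≤
... | xs , len , unique , xs∈ =
  map suc xs , trans (length-map suc xs) len , map⁺ suc-injective unique ,
  All.map⁺ (All.map there xs∈)

-- Maximal strong modules.

module Modules {n : ℕ} (G : Graph n) where
  open Graph G
  open Walks G

  module-adj : ∀ {M} → IsModule G M → ∀ {x x′ y} → x ∈ M → x′ ∈ M → y ∉ M → x ~ y → x′ ~ y
  module-adj {M} mod {x} {x′} {y} x∈ x′∈ y∉ e =
    ∈-tabulate⁻ (x′ ~?_) (p─q⊆p (N x′) M
      (subst (y ∈_) (mod x x′ x∈ x′∈) (x∈p∧x∉q⇒x∈p─q (∈-tabulate⁺ (x ~?_) e) y∉)))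

  singleton-strong : ∀ c → IsStrongModule G ⁅ c ⁆
  singleton-strong c = isModule , λ M′ _ → compare M′ (c ∈? M′)
    where
    isModule : IsModule G ⁅ c ⁆
    isModule x y x∈ y∈ rewrite x∈⁅y⁆⇒x≡y c x∈ | x∈⁅y⁆⇒x≡y c y∈ = refl

    compare : ∀ M′ → Dec (c ∈ M′) → ⁅ c ⁆ ⊆ M′ ⊎ M′ ⊆ ⁅ c ⁆ ⊎ Empty (⁅ c ⁆ ∩ M′)
    compare M′ (yes c∈) = inj₁ λ x∈ → subst (_∈ M′) (sym (x∈⁅y⁆⇒x≡y c x∈)) c∈
    compare M′ (no c∉)  = inj₂ (inj₂ λ (x , x∈) →
      let x∈c , x∈M′ = x∈p∩q⁻ ⁅ c ⁆ M′ x∈ in c∉ (subst (_∈ M′) (x∈⁅y⁆⇒x≡y c x∈c) x∈M′))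

  -- As long as a larger proper strong module exists, `M` is replaced by it; `n ∸ ∣ M ∣` decreases
  -- each time.
  below-maximal : ∀ M → IsStrongModule G M → M ≢ full → ∃ λ M′ → IsMaximalStrongModule G M′ × M ⊆ M′
  below-maximal M strong M≢full = 
    go M strong M≢full (<-wellFounded (n ∸ ∣ M ∣)) (anySubset? (larger? M))
    where
    ⊂-of : ∀ {p q : Subset n} → p ⊆ q → q ≢ p → p ⊂ q
    ⊂-of {p} {q} p⊆q q≢p with any? (λ x → (x ∈? q) ×-dec ¬? (x ∈? p))
    ... | yes extra = p⊆q , extra
    ... | no none   = contradiction
      (⊆-antisym (λ {x} x∈ → decidable-stable (x ∈? p) λ x∉ → none (x , x∈ , x∉)) p⊆q) q≢p

    Larger : Subset n → Subset n → Set
    Larger M M′ = IsStrongModule G M′ × M′ ≢ full × M ⊆ M′ × M′ ≢ M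

    larger? : ∀ M → U.Decidable (Larger M)
    larger? M M′ = isStrongModule? G M′ ×-dec
                   (¬? (M′ ≟ˢ full) ×-dec ((M ⊆? M′) ×-dec ¬? (M′ ≟ˢ M)))

    unextendable : ∀ {M} → IsStrongModule G M → M ≢ full → ¬ ∃ (Larger M) →
                   IsMaximalStrongModule G M
    unextendable {M} s f none = s , f , λ M′ s′ f′ M⊆M′ →
      decidable-stable (M′ ≟ˢ M) λ M′≢M → none (M′ , s′ , f′ , (λ {x} → M⊆M′ {x}) , M′≢M)

    go : ∀ M → IsStrongModule G M → M ≢ full → Acc _<_ (n ∸ ∣ M ∣) → Dec (∃ (Larger M)) →
         ∃ λ M′ → IsMaximalStrongModule G M′ × M ⊆ M′
    go M s f _ (no none) = M , unextendable s f none , id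
    go M s f (acc rs) (yes (M′ , s′ , f′ , M⊆M′ , M′≢M)) =
      let M⊂M′ = ⊂-of M⊆M′ M′≢M
          M″ , maximal , M′⊆M″ = go M′ s′ f′ (rs (∸-monoʳ-< (p⊂q⇒∣p∣<∣q∣ M⊂M′) (∣p∣≤n M′)))
                                    (anySubset? (larger? M′))
      in M″ , maximal , λ x∈ → M′⊆M″ (M⊆M′ x∈)

  -- Strong modules that meet are comparable, and comparable maximal ones are equal.
  maximal-disjoint : ∀ {M M′ c} → IsMaximalStrongModule G M → IsMaximalStrongModule G M′ →
                     c ∈ M → c ∈ M′ → M ≡ M′
  maximal-disjoint {M} {M′} {c} (s@(_ , comparable) , f , max) (s′ , f′ , max′) c∈M c∈M′
    with comparable M′ (proj₁ s′)
  ... | inj₁ M⊆M′         = sym (max M′ s′ f′ M⊆M′)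
  ... | inj₂ (inj₁ M′⊆M)  = max′ M s f M′⊆M
  ... | inj₂ (inj₂ empty) = contradiction (c , x∈p∩q⁺ (c∈M , c∈M′)) empty

  -- The empty set lies inside every singleton, which is a proper strong module, so it cannot be
  -- maximal.
  maximal-nonempty : Fin n → (∀ c → ⁅ c ⁆ ≢ full) → ∀ {M} → IsMaximalStrongModule G M → Nonempty M
  maximal-nonempty c proper {M} (_ , _ , max) with nonempty? M
  ... | yes nonempty = nonempty
  ... | no empty     = c , subst (c ∈_) c≡M (x∈⁅x⁆ c)
    where
    c≡M : ⁅ c ⁆ ≡ M
    c≡M = max ⁅ c ⁆ (singleton-strong c) (proper c) λ {x} x∈ → contradiction (x , x∈) empty

  moduleAt-maximal : ∀ i → IsMaximalStrongModule G (moduleAt G i)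
  moduleAt-maximal i = proj₂ (∈-filter⁻ (isMaximalStrongModule? G) {xs = allSubsets n} (∈-lookup i))

  moduleAt-injective : ∀ i j → moduleAt G i ≡ moduleAt G j → i ≡ j
  moduleAt-injective = lookup-injective (filter⁺ (isMaximalStrongModule? G) (allSubsets-unique n))

  moduleAt-surjective : ∀ {M} → IsMaximalStrongModule G M → ∃ λ i → M ≡ moduleAt G i
  moduleAt-surjective {M} maximal = index M∈ , lookup-index M∈
    where
    M∈ : M ∈ˡ maximalStrongModules G
    M∈ = ∈-filter⁺ (isMaximalStrongModule? G) (allSubsets-complete M) maximal

  singleton≢full : ∀ {a b : Fin n} → a ≢ b → ∀ c → ⁅ c ⁆ ≢ full
  singleton≢full a≢b c eq = a≢b (trans (all≡c _) (sym (all≡c _)))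
    where
    all≡c : ∀ d → d ≡ c
    all≡c d = x∈⁅y⁆⇒x≡y c (subst (d ∈_) (sym eq) ∈⊤)

-- Quotients by a partition into proper modules.

record IsModularQuotient {n m : ℕ} (G : Graph n) (H : Graph m) : Set where
  open Graph G
  open Graph H using () renaming (_~_ to _~ᴴ_)
  field
    block          : Fin m → Subset n
    block-module   : ∀ i → IsModule G (block i)
    block≢full     : ∀ i → block i ≢ full
    block-nonempty : ∀ i → Nonempty (block i)
    block-disjoint : ∀ {i j c} → c ∈ block i → c ∈ block j → i ≡ j
    block-of       : ∀ c → ∃ λ i → c ∈ block i
    block-adj⁺     : ∀ {i j x y} → i ~ᴴ j → x ∈ block i → y ∈ block j → x ~ y
    block-adj⁻     : ∀ {i j} → i ≢ j → (∀ {x y} → x ∈ block i → y ∈ block j → x ~ y) → i ~ᴴ j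

quotient-modular : ∀ {n} (G : Graph n) {a b : Fin n} → a ≢ b → IsModularQuotient G (quotient G)
quotient-modular G {a} a≢b = record
  { block          = moduleAt G
  ; block-module   = λ i → proj₁ (proj₁ (moduleAt-maximal i))
  ; block≢full     = λ i → proj₁ (proj₂ (moduleAt-maximal i))
  ; block-nonempty = λ i → maximal-nonempty a proper (moduleAt-maximal i)
  ; block-disjoint = λ {i} {j} c∈i c∈j → moduleAt-injective i j
                       (maximal-disjoint (moduleAt-maximal i) (moduleAt-maximal j) c∈i c∈j)
  ; block-of       = λ c →
      let M , maximal , c⊆M = below-maximal ⁅ c ⁆ (singleton-strong c) (proper c)
          i , M≡i = moduleAt-surjective maximal
      in i , subst (c ∈_) M≡i (c⊆M (x∈⁅x⁆ c))
  ; block-adj⁺     = λ (_ , adjacent) → adjacent _ _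
  ; block-adj⁻     = λ {i} {j} i≢j adjacent →
      (λ eq → i≢j (moduleAt-injective i j eq)) , λ _ _ → adjacent
  }
  where
  open Modules G
  proper : ∀ c → ⁅ c ⁆ ≢ full
  proper = singleton≢full a≢b

-- Representatives of the blocks and transfer of extremities.

module Representatives {n m : ℕ} (G : Graph n) (H : Graph m) (modular : IsModularQuotient G H)
                       (connected : ConnectedGraph G) {a b : Fin n}
                       (a≁b : ¬ Walks.Within G (_∈ full) 5 a b) where
  open Graph G
  open Walks G
  open Modules G
  open IsModularQuotient modular
  module H = Walks H
  open Graph H using () renaming (_~_ to _~ᴴ_; N[_] to Nᴴ[_])

  joined : ∀ x y → Joined (_∈ full) x y
  joined x y = path⇒joined (proj₂ (proj₂ connected x y ∈⊤ ∈⊤))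

  -- Two vertices of a proper module have a common neighbour outside it.
  separated : ∀ {M} → IsModule G M → M ≢ full → a ∈ M → b ∉ M
  separated {M} mod M≢full a∈ b∈ with any? (λ c → ¬? (c ∈? M))
  ... | no none = M≢full (⊆-antisym ⊆⊤ λ {c} _ → decidable-stable (c ∈? M) λ c∉ → none (c , c∉))
  ... | yes (c , c∉) =
    let p , q , _ , _ , p~q , p∈ , q∉ = crossing (_∈? M) (proj₂ (joined a c)) a∈ c∉
    in a≁b (2 , s≤s (s≤s z≤n) ,
            step ∈⊤ (module-adj mod p∈ a∈ q∉ p~q)
                 (step ∈⊤ (~-sym (module-adj mod p∈ b∈ q∉ p~q)) (here ∈⊤)))

  -- a and b are chosen whenever possible, so that both are representatives.
  choose : ∀ M → Nonempty M → Dec (a ∈ M) → Dec (b ∈ M) → Nonempty M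
  choose _ _        (yes a∈) _        = a , a∈
  choose _ _        (no _)   (yes b∈) = b , b∈
  choose _ nonempty (no _)   (no _)   = nonempty

  choose-a : ∀ {M} nonempty (a? : Dec (a ∈ M)) b? → a ∈ M → proj₁ (choose M nonempty a? b?) ≡ a
  choose-a _ (yes _) _ _  = refl
  choose-a _ (no a∉) _ a∈ = contradiction a∈ a∉

  choose-b : ∀ {M} nonempty (a? : Dec (a ∈ M)) b? → a ∉ M → b ∈ M →
             proj₁ (choose M nonempty a? b?) ≡ b
  choose-b _ (yes a∈) _       a∉ _  = contradiction a∈ a∉
  choose-b _ (no _)   (yes _) _  _  = refl
  choose-b _ (no _)   (no b∉) _  b∈ = contradiction b∈ b∉

  chosen : ∀ i → Nonempty (block i)
  chosen i = choose (block i) (block-nonempty i) (a ∈? _) (b ∈? _)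

  rep : Fin m → Fin n
  rep i = proj₁ (chosen i)

  rep∈ : ∀ i → rep i ∈ block i
  rep∈ i = proj₂ (chosen i)

  indexOf : Fin n → Fin m
  indexOf c = proj₁ (block-of c)

  ∈-indexOf : ∀ c → c ∈ block (indexOf c)
  ∈-indexOf c = proj₂ (block-of c)

  T : Vertices
  T c = ∃ λ i → rep i ≡ c

  T? : U.Decidable T
  T? c = any? (λ i → rep i ≟ c)

  Ta : T a
  Ta = indexOf a , choose-a _ (a ∈? _) (b ∈? _) (∈-indexOf a)

  -- `choose` prefers `a`, so `b` is a representative because, by `separated`, its block does not
  -- contain `a`.
  Tb : T b
  Tb = indexOf b , choose-b _ (a ∈? _) (b ∈? _) a∉ (∈-indexOf b)
    where
    a∉ : a ∉ block (indexOf b)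
    a∉ a∈ = separated (block-module (indexOf b)) (block≢full (indexOf b)) a∈ (∈-indexOf b)

  rep-injective : ∀ {i j} → rep i ≡ rep j → i ≡ j
  rep-injective {i} {j} eq = block-disjoint (rep∈ i) (subst (_∈ block j) (sym eq) (rep∈ j))

  -- The two ends of the edge are moved one at a time, each inside its own module.
  adj-between : ∀ {i j} → i ≢ j → ∀ {x x′ y y′} →
                x ∈ block i → x′ ∈ block i → y ∈ block j → y′ ∈ block j →
                x ~ y → x′ ~ y′
  adj-between {i} {j} i≢j x∈ x′∈ y∈ y′∈ x~y =
    ~-sym (module-adj (block-module j) y∈ y′∈ (λ x′∈j → i≢j (block-disjoint x′∈ x′∈j))
      (~-sym (module-adj (block-module i) x∈ x′∈ (λ y∈i → i≢j (block-disjoint y∈i y∈)) x~y)))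

  rep-adj⁺ : ∀ {i j} → i ~ᴴ j → rep i ~ rep j
  rep-adj⁺ e = block-adj⁺ e (rep∈ _) (rep∈ _)

  rep-adj⁻ : ∀ {i j} → rep i ~ rep j → i ~ᴴ j
  rep-adj⁻ {i} {j} e = block-adj⁻ i≢j λ x∈ y∈ → adj-between i≢j (rep∈ i) x∈ (rep∈ j) y∈ e
    where
    i≢j : i ≢ j
    i≢j refl = ~-irrefl refl e

  rep-near⁺ : ∀ {i j} → H.Near i j → Near (rep i) (rep j)
  rep-near⁺ (H.equal refl) = equal refl
  rep-near⁺ (H.adj e)      = adj (rep-adj⁺ e)

  rep-near⁻ : ∀ {i j} → Near (rep i) (rep j) → H.Near i j
  rep-near⁻ (equal eq) = H.equal (rep-injective eq)
  rep-near⁻ (adj e)    = H.adj (rep-adj⁻ e)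

  contract : ∀ {c d} → c ~ d → Dec (indexOf c ≡ indexOf d) →
             Near (rep (indexOf c)) (rep (indexOf d))
  contract _       (yes eq) = equal (cong rep eq)
  contract {c} {d} e (no i≢j) =
    adj (adj-between i≢j (∈-indexOf c) (rep∈ _) (∈-indexOf d) (rep∈ _) e)

  -- Each vertex of the walk is replaced by the representative of its block; an edge inside a block
  -- collapses, which can shorten the walk.
  contractʷ : ∀ {k c d} → Walk (_∈ full) k c d → Joined T (rep (indexOf c)) (rep (indexOf d))
  contractʷ (here _)     = 0 , here (_ , refl)
  contractʷ (step _ e w) =
    transʲ (nearʲ (_ , refl) (_ , refl) (contract e (indexOf _ ≟ indexOf _))) (contractʷ w)

  indexOf-rep : ∀ i → indexOf (rep i) ≡ i
  indexOf-rep i = block-disjoint (∈-indexOf (rep i)) (rep∈ i)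

  T-conn : Conn T
  T-conn (i , refl) (j , refl) =
    subst (Joined T (rep i)) (cong rep (indexOf-rep j))
      (subst (λ i′ → Joined T (rep i′) _) (indexOf-rep i)
        (contractʷ (proj₂ (joined (rep i) (rep j)))))

  module _ (i : Fin m) where

    far⁺ : ∀ {j} → j ∈ ∁ Nᴴ[ i ] → (T U.∩ Far (rep i)) (rep j)
    far⁺ {j} j∈ = (j , refl) , x∈∁p⇒x∉p j∈ ∘ H.near⇒N[] ∘ rep-near⁻

    far⁻ : ∀ {j} → Far (rep i) (rep j) → j ∈ ∁ Nᴴ[ i ]
    far⁻ far = x∉p⇒x∈∁p (far ∘ rep-near⁺ ∘ H.N[]⇒near)

    rep-walk : ∀ {k j l} → H.Walk (_∈ ∁ Nᴴ[ i ]) k j l → Walk (T U.∩ Far (rep i)) k (rep j) (rep l)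
    rep-walk (H.here j∈)     = here (far⁺ j∈)
    rep-walk (H.step j∈ e w) = step (far⁺ j∈) (rep-adj⁺ e) (rep-walk w)

    extremity⇒conn : IsExtremity H i → Conn (T U.∩ Far (rep i))
    extremity⇒conn ext ((j , refl) , far-j) ((l , refl) , far-l) =
      let k , w = H.path⇒joined (proj₂ (ext j l (far⁻ far-j) (far⁻ far-l)))
      in k , rep-walk w

  at-most-two : IsDPGraph G → ∀ I → IsIndependent H I →
                (∀ v → v ∈ I → IsExtremity H v) → ¬ 3 ≤ ∣ I ∣
  at-most-two dp I indep ext 3≤ with pick 3 I 3≤
  ... | u ∷ v ∷ w ∷ [] , refl , (u≢v ∷ u≢w ∷ []) ∷ (v≢w ∷ []) ∷ [] ∷ [] , u∈ ∷ v∈ ∷ w∈ ∷ [] =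
    no-three-extremities dp T? T-conn Ta Tb
      -- A walk inside `T` is a walk of `G`, so passing to `T` brings `a` and `b` no closer.
      (λ (k , k≤5 , walk) → a≁b (k , k≤5 , mapʷ (λ _ → ∈⊤) walk))
      (u , refl) (v , refl) (w , refl)
      (apart u∈ v∈ u≢v) (apart u∈ w∈ u≢w) (apart v∈ w∈ v≢w)
      (extremity⇒conn u (ext u u∈)) (extremity⇒conn v (ext v v∈)) (extremity⇒conn w (ext w w∈))
    where
    apart : ∀ {i j} → i ∈ I → j ∈ I → i ≢ j → ¬ Near (rep i) (rep j)
    apart i∈ j∈ i≢j near with rep-near⁻ near
    ... | H.equal eq = i≢j eq
    ... | H.adj e    = indep _ _ i∈ j∈ e

-- The bound for graphs of diameter at least six.

lemma17 : ∀ {n : ℕ} (G : Graph n) → ConnectedGraph G → IsDPGraph G →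
    ∀ (D : ℕ) → IsDiameter G D → 6 ≤ D → Ext G 2
lemma17 G connected dp D ((a , b , _ , minimal) , _) 6≤D =
  connected , λ I indep ext →
    ≮⇒≥ (at-most-two dp I indep ext)
  where
  open Walks G

  a≁b : ¬ Within (_∈ full) 5 a b
  a≁b (k , k≤5 , w) =
    -- `short` counts vertices and `minimal` edges, hence `pred-mono-≤`; together they give `D ≤ k`.
    let p , path , _ , short = walk⇒path id w
    in 1+n≰n (≤-trans 6≤D (≤-trans (minimal p path) (≤-trans (pred-mono-≤ short) k≤5)))

  -- Two distinct vertices make every singleton a proper subset, as `quotient-modular` requires.
  a≢b : a ≢ b
  a≢b refl = a≁b (0 , z≤n , here ∈⊤)

  open Representatives G (quotient G) (quotient-modular G a≢b) connected a≁b using (at-most-two)
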